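{- Classical (strictly competitive) co-synthesis fails for $\mathsf R$: for all refinements $\mathsf R'\preceq\mathsf R$, $$[\![\mathsf O\parallel\mathsf R'\parallel\mathsf{TTP}\parallel\mathrm{Sc}]\!]\not\subseteq\varphi_{\mathsf R}.$$
   Context: **Protocol model.** There are three (most general) processes: the originator $\mathsf O$, the recipient $\mathsf R$ and the trusted third party $\mathsf{TTP}$. Messages: $\mathsf O$ may send $m_1,m_3$ to $\mathsf R$ and $a_1^{\mathsf O}$ (abort request), $r_1^{\mathsf O}$ (resolve request) to $\mathsf{TTP}$; $\mathsf R$ may send $m_2,m_4$ to $\mathsf O$ and $r_1^{\mathsf R}$ (resolve request) to $\mathsf{TTP}$; $\mathsf{TTP}$ may send $a_2^{\mathsf O}$ (abort token) or $r_2^{\mathsf O}$ (replacement for $\mathsf R$'s signature) to $\mathsf O$, and $a_2^{\mathsf R}$ (abort token) or $r_2^{\mathsf R}$ (replacement for $\mathsf O$'s signature) to $\mathsf R$. Each process, when scheduled, chooses a move: the idle move $\iota$ or sending a message it is able to compose; the $\mathsf{TTP}$ also has the moves $[a_2^{\mathsf O},a_2^{\mathsf R}]$ and $[r_2^{\mathsf O},r_2^{\mathsf R}]$, each sending both listed messages (in some order). Composability: $\mathsf R$ can send $m_2$ only after receiving $m_1$; $\mathsf O$ can send $m_3$ only after receiving $m_2$; $\mathsf R$ can send $m_4$ only after receiving $m_3$; $\mathsf O$ can send $r_1^{\mathsf O}$ only after receiving $m_2$; $\mathsf R$ can send $r_1^{\mathsf R}$ only after receiving $m_1$; $\mathsf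 O$ can send $m_1$ and $a_1^{\mathsf O}$ from the start. The most general processes may choose any composable move at any state. The $\mathsf{TTP}$ is *reasonable*: it never sends a message unless it has received an abort or resolve request; it processes messages first-in-first-out; if the first request received is an abort request it eventually sends an abort token; if the first request received is a resolve request it eventually sends an agent signature. **Predicates** (Boolean variables, initially false, monotonic: once true they stay true). Set by $\mathsf O$: $M_1$, $M_3$, $\mathrm{ABR}^{\mathsf O}$, $\mathrm{RES}^{\mathsf O}$ on sending $m_1,m_3,a_1^{\mathsf O},r_1^{\mathsf O}$; $\mathrm{EOR}$ on receiving $m_2$ or $r_2^{\mathsf O}$; $\mathrm{Sig}_{\mathsf R}^{\mathsf R}$ on receiving $m_4$; $\mathrm{Sig}_{\mathsf R}^{\mathsf{TTP}}$ on receiving $r_2^{\mathsf O}$; $\mathrm{AB}_{\mathsf O}$ on receiving $a_2^{\mathsf O}$. Set by $\mathsf R$: $M_2,M_4,\mathrm{RES}^{\mathsf R}$ on sending $m_2,m_4,r_1^{\mathsf R}$; $\mathrm{EOO}$ on receiving $m_1$ or $r_2^{\mathsf R}$; $\mathrm{Sig}_{\mathsf O}^{\mathsf O}$ on receiving $m_3$; $\mathrm{Sig}_{\mathsf O}^{\mathsf{TTP}}$ on receiving $r_2^{\mathsf R}$; $\mathrm{AB}_{\mathsf R}$ on receiving $a_2^{\mathsf R}$. Set by $\mathsf{TTP}$: $\mathrm{ABR}$ on receiving $a_1^{\mathsf O}$; $\mathrm{RES}$ on receiving $r_1^{\mathsf O}$ or $r_1^{\mathsf R}$; $A_2^{\mathsf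 O},A_2^{\mathsf R},R_2^{\mathsf O},R_2^{\mathsf R}$ on sending $a_2^{\mathsf O},a_2^{\mathsf R},r_2^{\mathsf O},r_2^{\mathsf R}$. A state is a valuation of all these variables; each process sees only the variables it sets. **Refinement.** $P'\preceq P$ means that $P'$ has the same variables as $P$, and at every valuation of those variables a nonempty subset of the moves of $P$, with the same effect. **Traces.** Channels between $\mathsf O$ and $\mathsf R$ are unreliable (messages may never be delivered); channels between each agent and the $\mathsf{TTP}$ are resilient (every message is eventually delivered, without a fixed bound and possibly out of order). A scheduler assigns turns to the processes as a function of the history; it is fair if every process gets infinitely many turns. $[\![P_1\parallel P_2\parallel P_3\parallel\mathrm{Sc}]\!]$ denotes the set of infinite sequences of valuations, starting from the all-false valuation, generated by the processes under all fair schedulers $\mathrm{Sc}$ and all allowed channel behaviours. A formula is identified with the set of traces satisfying it. **Objective of $\mathsf R$** (LTL; $\Box$ = always, $\Diamond$ = eventually): $\varphi_{\mathsf R}=\Box\big[\mathrm{EOO}\Rightarrow\big((\Diamond\mathrm{Sig}_{\mathsf O}^{\mathsf O}\vee(\Diamond\mathrm{Sig}_{\mathsf O}^{\mathsf{TTP}}\wedge\Box\neg\mathrm{AB}_{\mathsf R}))\vee(\Diamond\mathrm{AB}_{\mathsf R}\wedge\Box(\neg\mathrm{Sig}_{\mathsf R}^{\mathsf R}\wedge\neg\mathrm{Sig}_{\mathsf R}^{\mathsf{TTP}}))\big)\big]$. -}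

module Defs where

open import Level using (0ℓ)
open import Data.Bool using (Bool; false; T; _∨_)
open import Data.List using (List; applyUpTo)
open import Data.Maybe using (Maybe; just)
open import Data.Nat using (ℕ; suc; _+_; _≤_; _<_)
open import Data.Product using (Σ-syntax; ∃; ∃-syntax; _×_; _,_; proj₁; proj₂)
open import Data.Sum using (_⊎_)
open import Data.Unit using (⊤)
open import Function.Bundles using (_⇔_)
open import Relation.Binary.PropositionalEquality using (_≡_)
open import Relation.Nullary using (¬_)
open import Relation.Unary using (Pred; _∈_; _∪_; _∩_; _⇒_; _≐_; ∁; Satisfiable)

data Agent : Set where
  O R TTP : Agent

private variable
  p q s : Agent

data Msg : (from to : Agent) → Set where
  m₁ m₃   : Msg O R
  m₂ m₄   : Msg R O
  a₁ᴼ r₁ᴼ : Msg O TTP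
  r₁ᴿ     : Msg R TTP
  a₂ᴼ r₂ᴼ : Msg TTP O
  a₂ᴿ r₂ᴿ : Msg TTP R

data Move : Agent → Set where
  ι                     : Move p
  send                  : Msg p q → Move p
  [a₂ᴼ,a₂ᴿ] [r₂ᴼ,r₂ᴿ] : Move TTP

-- In the two double moves the messages go to different agents over
-- asynchronous channels, so the order in which they leave is not recorded.
data _Sends_ : Move p → Msg s q → Set where
  single   : {m : Msg p q} → send m Sends m
  abortᴼ   : [a₂ᴼ,a₂ᴿ] Sends a₂ᴼ
  abortᴿ   : [a₂ᴼ,a₂ᴿ] Sends a₂ᴿ
  resolveᴼ : [r₂ᴼ,r₂ᴿ] Sends r₂ᴼ
  resolveᴿ : [r₂ᴼ,r₂ᴿ] Sends r₂ᴿ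

-- Sigᴬ^B is the signature of A supplied by B.
data Var : Agent → Set where
  M₁ M₃ ABRᴼ RESᴼ EOR Sigᴿ^R Sigᴿ^TTP ABₒ : Var O
  M₂ M₄ RESᴿ EOO Sigᴼ^O Sigᴼ^TTP ABᵣ       : Var R
  ABR RES A₂ᴼ A₂ᴿ R₂ᴼ R₂ᴿ                   : Var TTP

LocalValuation : Agent → Set
LocalValuation p = Var p → Bool

Valuation : Set
Valuation = ∀ p → LocalValuation p

-- What an agent has sent and received so far.  This fixes the values of the
-- agent's variables, but not conversely: EOO, for example, is set by m₁ and
-- by r₂ᴿ, whereas sending m₂ requires that m₁ itself was received.
record Local (p : Agent) : Set where
  field
    sent : Msg p q → Bool
    rcvd : Msg q p → Bool

open Local public

val : Local p → LocalValuation p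
val l M₁       = sent l m₁
val l M₃       = sent l m₃
val l ABRᴼ     = sent l a₁ᴼ
val l RESᴼ     = sent l r₁ᴼ
val l EOR      = rcvd l m₂ ∨ rcvd l r₂ᴼ
val l Sigᴿ^R   = rcvd l m₄
val l Sigᴿ^TTP = rcvd l r₂ᴼ
val l ABₒ      = rcvd l a₂ᴼ
val l M₂       = sent l m₂
val l M₄       = sent l m₄
val l RESᴿ     = sent l r₁ᴿ
val l EOO      = rcvd l m₁ ∨ rcvd l r₂ᴿ
val l Sigᴼ^O   = rcvd l m₃
val l Sigᴼ^TTP = rcvd l r₂ᴿ
val l ABᵣ      = rcvd l a₂ᴿ
val l ABR      = rcvd l a₁ᴼ
val l RES      = rcvd l r₁ᴼ ∨ rcvd l r₁ᴿ
val l A₂ᴼ      = sent l a₂ᴼ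
val l A₂ᴿ      = sent l a₂ᴿ
val l R₂ᴼ      = sent l r₂ᴼ
val l R₂ᴿ      = sent l r₂ᴿ

Requested : Local TTP → Set
Requested l = T (rcvd l a₁ᴼ ∨ rcvd l r₁ᴼ ∨ rcvd l r₁ᴿ)

-- The clauses for the TTP are the safety part of its being reasonable.
Composable : Local p → Msg p q → Set
Composable l m₁  = ⊤
Composable l m₂  = T (rcvd l m₁)
Composable l m₃  = T (rcvd l m₂)
Composable l m₄  = T (rcvd l m₃)
Composable l a₁ᴼ = ⊤
Composable l r₁ᴼ = T (rcvd l m₂)
Composable l r₁ᴿ = T (rcvd l m₁)
Composable l a₂ᴼ = Requested l
Composable l r₂ᴼ = Requested l
Composable l a₂ᴿ = Requested l
Composable l r₂ᴿ = Requested l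

Process : Agent → Set₁
Process p = Local p → Pred (Move p) 0ℓ

mostGeneral : ∀ p → Process p
mostGeneral p l μ = ∀ {q} {m : Msg p q} → μ Sends m → Composable l m

-- Composability is monotone in what has been received, so this excludes only
-- local states that no execution reaches.
Coherent : Local p → Set
Coherent {p} l = ∀ {q} {m : Msg p q} → T (sent l m) → Composable l m

-- A refinement selects moves by looking at the valuation of the process's own
-- variables only; the effect of a move is the same for all processes.
_⪯_ : Process p → Process p → Set₁
_⪯_ {p} P′ P =
  (Σ[ select ∈ (LocalValuation p → Pred (Move p) 0ℓ) ]
     ∀ l → P′ l ≐ (P l ∩ select (val l)))
  × (∀ l → Coherent l → Satisfiable (P′ l))

Trace : Set
Trace = ℕ → Valuation

history : Trace → ℕ → List Valuation
history ρ k = applyUpTo ρ (suc k)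

Scheduler : Set
Scheduler = List Valuation → Agent

Fair : Scheduler → Set
Fair Sc = ∀ ρ p n → ∃[ k ] n ≤ k × Sc (history ρ k) ≡ p

Packet : Set
Packet = ∃[ p ] ∃[ q ] Msg p q

Resilient : Msg p q → Set
Resilient {p} {q} m = p ≡ TTP ⊎ q ≡ TTP

-- Step k leads from state k to state (suc k): one agent makes its move and
-- the channels deliver at most one message sent in an earlier step.  A message
-- instance is identified by the step in which it was sent.
record Behaviour : Set where
  field
    action    : ℕ → ∃ Move
    delivered : ℕ → Maybe (ℕ × Packet)
    state     : ℕ → ∀ p → Local p

  SentAt : ℕ → Msg p q → Set
  SentAt k m = proj₂ (action k) Sends m

  -- Message m, sent in step n, is delivered in step k.
  DeliveredAt : ℕ → ℕ → Msg p q → Set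
  DeliveredAt k n m = delivered k ≡ just (n , _ , _ , m)

  -- The TTP receives requests one at a time, in order of delivery; first-in-
  -- first-out processing makes the first one delivered the one that counts.
  FirstRequest : Msg p TTP → Set
  FirstRequest m = ∃[ k ]
    (∃[ n ] DeliveredAt k n m) ×
    (∀ {j n p} {m′ : Msg p TTP} → j < k → ¬ DeliveredAt j n m′)

record Valid (P : ∀ p → Process p) (Sc : Scheduler) (ρ : Trace)
             (b : Behaviour) : Set where
  open Behaviour b
  field
    scheduled : ∀ k → proj₁ (action k) ≡ Sc (history ρ k)
    permitted : ∀ k → let (p , μ) = action k in μ ∈ P p (state k p)

    nothing-sent : (m : Msg p q) → sent (state 0 p) m ≡ false
    nothing-rcvd : (m : Msg q p) → rcvd (state 0 p) m ≡ false
    sending      : ∀ k (m : Msg p q) →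
      T (sent (state (suc k) p) m) ⇔ (T (sent (state k p) m) ⊎ SentAt k m)
    receiving    : ∀ k (m : Msg q p) →
      T (rcvd (state (suc k) p) m) ⇔
      (T (rcvd (state k p) m) ⊎ ∃[ n ] DeliveredAt k n m)

    causal       : ∀ {k n} {m : Msg p q} → DeliveredAt k n m → n < k × SentAt n m
    unduplicated : ∀ {j k n} {m : Msg p q} →
      DeliveredAt j n m → DeliveredAt k n m → j ≡ k
    resilient    : ∀ {n} {m : Msg p q} →
      Resilient m → SentAt n m → ∃[ k ] DeliveredAt k n m

    abort-first   : FirstRequest a₁ᴼ → ∃[ k ] (SentAt k a₂ᴼ ⊎ SentAt k a₂ᴿ)
    resolve-first : FirstRequest r₁ᴼ ⊎ FirstRequest r₁ᴿ →
                    ∃[ k ] (SentAt k r₂ᴼ ⊎ SentAt k r₂ᴿ)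

    observed : ∀ k p (v : Var p) → ρ k p v ≡ val (state k p) v

byAgent : Process O → Process R → Process TTP → ∀ p → Process p
byAgent P₁ P₂ P₃ O   = P₁
byAgent P₁ P₂ P₃ R   = P₂
byAgent P₁ P₂ P₃ TTP = P₃

⟦_∥_∥_∥Sc⟧ : Process O → Process R → Process TTP → Pred Trace 0ℓ
⟦ P₁ ∥ P₂ ∥ P₃ ∥Sc⟧ ρ =
  ∃[ Sc ] Fair Sc × ∃ (Valid (byAgent P₁ P₂ P₃) Sc ρ)

Formula : Set₁
Formula = Pred Trace 0ℓ

⟨_⟩ : Var p → Formula
⟨ v ⟩ ρ = T (ρ 0 _ v)

□ ◇ : Formula → Formula
□ φ ρ = ∀ n → (λ k → ρ (n + k)) ∈ φ
◇ φ ρ = ∃[ n ] (λ k → ρ (n + k)) ∈ φ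

φᴿ : Formula
φᴿ = □ (⟨ EOO ⟩ ⇒
  ((◇ ⟨ Sigᴼ^O ⟩ ∪ (◇ ⟨ Sigᴼ^TTP ⟩ ∩ □ (∁ ⟨ ABᵣ ⟩)))
   ∪ (◇ ⟨ ABᵣ ⟩ ∩ □ (∁ ⟨ Sigᴿ^R ⟩ ∩ ∁ ⟨ Sigᴿ^TTP ⟩))))

{-# OPTIONS --safe #-}
-- The originator requests an abort and then sends m₁; the TTP answers the abort
-- request with the single message a₂ᴼ, which is all that its being reasonable
-- requires.  From then on both stay idle.  Whatever the recipient does, the
-- first request is the abort request, so after m₁ the recipient holds EOO but
-- never gets a signature or an abort token.  Delivering every message one step
-- after it was sent respects the resilience of the channels.
module Submission where

open import Data.Bool using (false; _∨_; T)
open import Data.Bool.Properties using (T-∨)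
open import Data.Empty using (⊥-elim)
open import Data.List using ([]; _∷_; length)
open import Data.List.Properties using (length-applyUpTo)
open import Data.Maybe using (Maybe; just; nothing; map)
import Data.Maybe.Properties as Maybe
open import Data.Nat using (ℕ; suc; _+_; _*_; s≤s; z≤n)
import Data.Nat.Properties as ℕ
open import Data.Product using (∃; ∃-syntax; _×_; _,_; proj₁; proj₂)
open import Data.Sum using (_⊎_; inj₁; inj₂; [_,_]′) renaming (map to ⊎-map)
open import Data.Unit using (tt)
open import Defs
open import Function using (_∘_; case_of_; id)
open import Function.Bundles using (_⇔_; mk⇔; mk↣; module Equivalence)
open import Relation.Binary using (DecidableEquality)
open import Relation.Binary.PropositionalEquality using (_≡_; refl; sym; trans; cong; subst)
open import Relation.Nullary using (¬_; Dec)
open import Relation.Nullary.Decidable using (⌊_⌋; toWitness; fromWitness; via-injection)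
open import Relation.Unary using (_∈_; _⊆_; _⊈_; Satisfiable)

open Equivalence using (to; from)

private variable
  p q s : Agent

-- Decidable equality of messages.

code : Packet → ℕ
code (_ , _ , m₁)  = 0
code (_ , _ , m₃)  = 1
code (_ , _ , m₂)  = 2
code (_ , _ , m₄)  = 3
code (_ , _ , a₁ᴼ) = 4
code (_ , _ , r₁ᴼ) = 5
code (_ , _ , r₁ᴿ) = 6
code (_ , _ , a₂ᴼ) = 7
code (_ , _ , r₂ᴼ) = 8
code (_ , _ , a₂ᴿ) = 9
code (_ , _ , r₂ᴿ) = 10

decode : ℕ → Packet
decode 0 = _ , _ , m₁
decode 1 = _ , _ , m₃
decode 2 = _ , _ , m₂
decode 3 = _ , _ , m₄
decode 4 = _ , _ , a₁ᴼ
decode 5 = _ , _ , r₁ᴼ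
decode 6 = _ , _ , r₁ᴿ
decode 7 = _ , _ , a₂ᴼ
decode 8 = _ , _ , r₂ᴼ
decode 9 = _ , _ , a₂ᴿ
decode _ = _ , _ , r₂ᴿ

decode-code : ∀ x → decode (code x) ≡ x
decode-code (_ , _ , m₁)  = refl
decode-code (_ , _ , m₃)  = refl
decode-code (_ , _ , m₂)  = refl
decode-code (_ , _ , m₄)  = refl
decode-code (_ , _ , a₁ᴼ) = refl
decode-code (_ , _ , r₁ᴼ) = refl
decode-code (_ , _ , r₁ᴿ) = refl
decode-code (_ , _ , a₂ᴼ) = refl
decode-code (_ , _ , r₂ᴼ) = refl
decode-code (_ , _ , a₂ᴿ) = refl
decode-code (_ , _ , r₂ᴿ) = refl

-- Going through a code with a left inverse keeps the number of cases linear in the number of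
-- messages. Decidability is what lets `advance` compute Boolean values.
_≟ᴾ_ : DecidableEquality Packet
_≟ᴾ_ = via-injection (mk↣ code-injective) ℕ._≟_
  where
  code-injective : ∀ {x y} → code x ≡ code y → x ≡ y
  code-injective {x} {y} eq =
    trans (sym (decode-code x)) (trans (cong decode eq) (decode-code y))

_≟ᴹ_ : DecidableEquality (Maybe Packet)
_≟ᴹ_ = Maybe.≡-dec _≟ᴾ_

packet : Msg p q → Packet
packet m = _ , _ , m

-- The moves that send at most one message.
Act : Agent → Set
Act p = Maybe (∃ (Msg p))

move : Act p → Move p
move nothing        = ι
move (just (_ , m)) = send m

output : ∃ Act → Maybe Packet
output (p , a) = map (p ,_) a

-- Both double moves belong to the `TTP`, so describing the recipient by `Act` loses none of the
-- moves that a refinement may pick.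
move-surjective : (μ : Move R) → ∃[ a ] move a ≡ μ
move-surjective ι        = nothing , refl
move-surjective (send m) = just (_ , m) , refl

sends⇒output : (x : ∃ Act) {m : Msg p q} →
  move (proj₂ x) Sends m → output x ≡ just (packet m)
sends⇒output (_ , just _) single = refl

output⇒sends : (x : ∃ Act) {m : Msg p q} →
  output x ≡ just (packet m) → move (proj₂ x) Sends m
output⇒sends (_ , just _) refl = single

-- One update serves all agents: a packet carries its sender and receiver, so comparing packets also
-- decides whether the agent is concerned.
advance : (out inn : Maybe Packet) → Local p → Local p
advance out inn l .sent m = sent l m ∨ ⌊ out ≟ᴹ just (packet m) ⌋
advance out inn l .rcvd m = rcvd l m ∨ ⌊ inn ≟ᴹ just (packet m) ⌋

T-∨-⌊⌋ : ∀ {x} {A : Set} (a? : Dec A) → T (x ∨ ⌊ a? ⌋) ⇔ (T x ⊎ A)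
T-∨-⌊⌋ a? = mk⇔ (⊎-map id (toWitness {a? = a?}) ∘ to T-∨)
                (from T-∨ ∘ ⊎-map id (fromWitness {a? = a?}))

composable-mono : {l l′ : Local R} → (∀ {q} (m : Msg q R) → T (rcvd l m) → T (rcvd l′ m)) →
  (m : Msg R q) → Composable l m → Composable l′ m
composable-mono l⊆l′ m₂  = l⊆l′ m₁
composable-mono l⊆l′ m₄  = l⊆l′ m₃
composable-mono l⊆l′ r₁ᴿ = l⊆l′ m₁

-- A fair scheduler.

turn : ℕ → Agent
turn 0                   = O
turn 1                   = TTP
turn 2                   = R
turn (suc (suc (suc n))) = turn n

roundRobin : Scheduler
roundRobin []      = O
-- `history ρ k` has `suc k` entries, so its tail has length `k`, the number of the step.
roundRobin (_ ∷ h) = turn (length h)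

roundRobin-turn : ∀ ρ k → roundRobin (history ρ k) ≡ turn k
roundRobin-turn ρ k = cong turn (length-applyUpTo (ρ ∘ suc) k)

turn-periodic : ∀ n r → turn (n * 3 + r) ≡ turn r
turn-periodic 0       r = refl
turn-periodic (suc n) r = turn-periodic n r

turn-surjective : ∀ p → ∃[ r ] turn r ≡ p
turn-surjective O   = 0 , refl
turn-surjective TTP = 1 , refl
turn-surjective R   = 2 , refl

roundRobin-fair : Fair roundRobin
roundRobin-fair ρ p n =
  let (r , turn-r) = turn-surjective p in
  n * 3 + r ,
  ℕ.≤-trans (ℕ.m≤m*n n 3) (ℕ.m≤m+n (n * 3) r) ,
  trans (roundRobin-turn ρ (n * 3 + r)) (trans (turn-periodic n r) turn-r)

-- The scripts of the originator and the `TTP`.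

actᴼ : ℕ → Act O
actᴼ 0 = just (_ , a₁ᴼ)
-- By now `a₁ᴼ` has reached the `TTP`, and without `m₁` the recipient could not have composed `r₁ᴿ`
-- before.
actᴼ 3 = just (_ , m₁)
actᴼ _ = nothing

-- The first turn of the TTP after the delivery of a₁ᴼ is in step 4.
actᵀ : ℕ → Act TTP
actᵀ 4 = just (_ , a₂ᴼ)
actᵀ _ = nothing

data Scriptedᴼ : Msg O q → Set where
  a₁ᴼ : Scriptedᴼ a₁ᴼ
  m₁  : Scriptedᴼ m₁

actᴼ-scripted : ∀ k {m : Msg O q} → move (actᴼ k) Sends m → Scriptedᴼ m
actᴼ-scripted 0 single = a₁ᴼ
actᴼ-scripted 3 single = m₁
actᴼ-scripted 1 ()
actᴼ-scripted 2 ()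
actᴼ-scripted (suc (suc (suc (suc _)))) ()

-- The step is an index, unlike in `Scriptedᴼ`, because `a₂ᴼ` is composable only after a request: in
-- state 4 `Requested` evaluates to true. The messages of `Scriptedᴼ` are composable from the start.
data Scriptedᵀ : ℕ → Msg TTP q → Set where
  a₂ᴼ : Scriptedᵀ 4 a₂ᴼ

actᵀ-scripted : ∀ k {m : Msg TTP q} → move (actᵀ k) Sends m → Scriptedᵀ k m
actᵀ-scripted 4 single = a₂ᴼ
actᵀ-scripted 0 ()
actᵀ-scripted 1 ()
actᵀ-scripted 2 ()
actᵀ-scripted 3 ()
actᵀ-scripted (suc (suc (suc (suc (suc _))))) ()

sender : {a : Act p} {m : Msg s q} → move a Sends m → p ≡ s
sender {a = just _} single = refl

-- The run against a given refinement of the recipient.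

module Counterexample
  (R′ : Process R)
  (R′⊆R : ∀ l → R′ l ⊆ mostGeneral R l)
  (R′-moves : ∀ l → Coherent l → Satisfiable (R′ l))
  where

  choose : ∀ l → Coherent l → ∃[ a ] move a ∈ R′ l
  choose l coh =
    let (μ , μ∈R′) = R′-moves l coh
        (a , eq)   = move-surjective μ
    in a , subst (R′ l) (sym eq) μ∈R′

  -- Coherence travels with the state because a refinement is guaranteed a move only in coherent
  -- states. One slot for messages in flight suffices, since each step sends at most one message and
  -- the next step delivers it.
  record Config : Set where
    field
      local    : ∀ p → Local p
      inFlight : Maybe (ℕ × Packet)
      coherent : Coherent (local R)

  open Config

  act : ℕ → Config → ∀ p → Act p
  act k c O   = actᴼ k
  act k c TTP = actᵀ k
  act k c R   = proj₁ (choose (local c R) (coherent c))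

  acts : ℕ → Config → ∃ Act
  acts k c = turn k , act k c (turn k)

  act-composableᴿ : ∀ k c p {m : Msg R q} →
    move (act k c p) Sends m → Composable (local c R) m
  act-composableᴿ k c R sends =
    R′⊆R (local c R) (proj₂ (choose (local c R) (coherent c))) sends
  act-composableᴿ k c O   sends = case sender {a = act k c O} sends of λ ()
  act-composableᴿ k c TTP sends = case sender {a = act k c TTP} sends of λ ()

  step : ℕ → Config → Config
  step k c .local p  = advance (output (acts k c)) (map proj₂ (inFlight c)) (local c p)
  step k c .inFlight = map (k ,_) (output (acts k c))
  step k c .coherent {m = m} =
    -- Whether the message was sent earlier or in this very step, it was composable in the old
    -- state, and receiving more preserves that.
    composable-mono (λ _ → from T-∨ ∘ inj₁) m ∘
    [ coherent c , act-composableᴿ k c (turn k) ∘ output⇒sends (acts k c) ]′ ∘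
    to (T-∨-⌊⌋ (output (acts k c) ≟ᴹ just (packet m)))

  run : ℕ → Config
  run 0 = record
    { local    = λ _ → record { sent = λ _ → false ; rcvd = λ _ → false }
    ; inFlight = nothing
    ; coherent = λ ()
    }
  run (suc k) = step k (run k)

  behaviour : Behaviour
  behaviour = record
    { action    = λ k → turn k , move (act k (run k) (turn k))
    ; delivered = inFlight ∘ run
    ; state     = local ∘ run
    }

  open Behaviour behaviour

  trace : Trace
  trace k p = val (state k p)

  -- Validity of the run.

  sending : ∀ k (m : Msg p q) →
    T (sent (state (suc k) p) m) ⇔ (T (sent (state k p) m) ⊎ SentAt k m)
  sending k m = mk⇔ (⊎-map id (output⇒sends x) ∘ to split)
                    (from split ∘ ⊎-map id (sends⇒output x))
    where
    x     = acts k (run k)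
    split = T-∨-⌊⌋ (output x ≟ᴹ just (packet m))

  map-proj₂≡just : ∀ {A B : Set} (x : Maybe (A × B)) {b} →
    map proj₂ x ≡ just b ⇔ (∃[ a ] x ≡ just (a , b))
  map-proj₂≡just (just _) = mk⇔ (λ { refl → _ , refl }) (λ { (_ , refl) → refl })
  map-proj₂≡just nothing  = mk⇔ (λ ()) (λ ())

  receiving : ∀ k (m : Msg q p) →
    T (rcvd (state (suc k) p) m) ⇔
    (T (rcvd (state k p) m) ⊎ ∃[ n ] DeliveredAt k n m)
  receiving k m = mk⇔ (⊎-map id (to eq) ∘ to split) (from split ∘ ⊎-map id (from eq))
    where
    eq    = map-proj₂≡just (inFlight (run k))
    split = T-∨-⌊⌋ (map proj₂ (inFlight (run k)) ≟ᴹ just (packet m))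

  -- The slot in flight is overwritten in every step. As the step of sending determines that of
  -- delivery, causality and the absence of duplicates both follow.
  delivered⇒sent : ∀ k {n} {m : Msg p q} → DeliveredAt k n m → k ≡ suc n × SentAt n m
  delivered⇒sent (suc k) eq with output (acts k (run k)) in out
  delivered⇒sent (suc k) refl | just _ = refl , output⇒sends (acts k (run k)) out

  sent⇒delivered : ∀ n {m : Msg p q} → SentAt n m → DeliveredAt (suc n) n m
  sent⇒delivered n = cong (map (n ,_)) ∘ sends⇒output (acts n (run n))

  -- This reduces what the recipient never receives to what the two scripts never send.
  rcvd⇒sent : ∀ k {m : Msg p q} → T (rcvd (state k q) m) → ∃[ n ] SentAt n m
  rcvd⇒sent (suc k) {m} r with to (receiving k m) r
  ... | inj₁ r′       = rcvd⇒sent k r′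
  ... | inj₂ (n , eq) = n , proj₂ (delivered⇒sent k eq)

  sentᴼ : ∀ k {m : Msg O q} → SentAt k m → Scriptedᴼ m
  sentᴼ k sends with turn k
  ... | O   = actᴼ-scripted k sends
  ... | R   = case sender {a = act k (run k) R} sends of λ ()
  ... | TTP = case sender {a = actᵀ k} sends of λ ()

  sentᵀ : ∀ k {m : Msg TTP q} → SentAt k m → Scriptedᵀ k m
  sentᵀ k sends with turn k
  ... | TTP = actᵀ-scripted k sends
  ... | O   = case sender {a = actᴼ k} sends of λ ()
  ... | R   = case sender {a = act k (run k) R} sends of λ ()

  processes : ∀ p → Process p
  processes = byAgent (mostGeneral O) R′ (mostGeneral TTP)

  permitted : ∀ k p → move (act k (run k) p) ∈ processes p (state k p)
  permitted k R = proj₂ (choose (state k R) (coherent (run k)))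
  permitted k O sends with actᴼ-scripted k sends
  ... | a₁ᴼ = tt
  ... | m₁  = tt
  permitted k TTP sends with actᵀ-scripted k sends
  ... | a₂ᴼ = tt

  -- The delivery of a₁ᴼ in step 1 precedes that of any other request.
  first-request : {m : Msg p TTP} → FirstRequest m → packet m ≡ packet a₁ᴼ
  first-request (1 , (_ , refl) , _)           = refl
  first-request (suc (suc k) , _ , no-earlier) = ⊥-elim (no-earlier (s≤s (s≤s z≤n)) refl)

  valid : Valid processes roundRobin trace behaviour
  valid = record
    { scheduled     = λ k → sym (roundRobin-turn trace k)
    ; permitted     = λ k → permitted k (turn k)
    ; nothing-sent  = λ _ → refl
    ; nothing-rcvd  = λ _ → refl
    ; sending       = sending
    ; receiving     = receiving
    ; causal        = λ {k = k} d → case delivered⇒sent k d of λ { (refl , s) → ℕ.≤-refl , s }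
    ; unduplicated  = λ {j = j} {k = k} d d′ →
        trans (proj₁ (delivered⇒sent j d)) (sym (proj₁ (delivered⇒sent k d′)))
    ; resilient     = λ {n = n} _ s → suc n , sent⇒delivered n s
    ; abort-first   = λ _ → 4 , inj₁ single
    -- Vacuous: the first request is `a₁ᴼ`, whose packet differs from those of both resolve
    -- requests.
    ; resolve-first = λ { (inj₁ r) → case first-request r of λ ()
                        ; (inj₂ r) → case first-request r of λ () }
    ; observed      = λ _ _ _ → refl
    }

  -- Failure of the objective.

  no-m₃ : ∀ k → ¬ T (rcvd (state k R) m₃)
  no-m₃ k r = case rcvd⇒sent k r of λ (n , s) → case sentᴼ n s of λ ()

  no-token : ∀ k → ¬ T (rcvd (state k R) a₂ᴿ)
  no-token k r = case rcvd⇒sent k r of λ (n , s) → case sentᵀ n s of λ ()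

  no-replacement : ∀ k → ¬ T (rcvd (state k R) r₂ᴿ)
  no-replacement k r = case rcvd⇒sent k r of λ (n , s) → case sentᵀ n s of λ ()

  trace∉φᴿ : ¬ trace ∈ φᴿ
  -- Sent in step 3 and delivered in step 4, `m₁` makes `EOO` true in state 5.
  trace∉φᴿ φ with φ 5 (from T-∨ (inj₁ (from (receiving 4 m₁) (inj₂ (3 , refl)))))
  -- Each disjunct fails already by its eventuality. The atom is read at index 0 of the trace
  -- shifted first by 5 and then by `n`.
  ... | inj₁ (inj₁ (n , sig))       = no-m₃ (5 + (n + 0)) sig
  ... | inj₁ (inj₂ ((n , sig) , _)) = no-replacement (5 + (n + 0)) sig
  ... | inj₂ ((n , ab) , _)         = no-token (5 + (n + 0)) ab

theorem3 : (R′ : Process R) → R′ ⪯ mostGeneral R →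
    ⟦ mostGeneral O ∥ R′ ∥ mostGeneral TTP ∥Sc⟧ ⊈ φᴿ
theorem3 R′ ((_ , R′≐) , R′-moves) traces⊆φᴿ =
  trace∉φᴿ (traces⊆φᴿ (roundRobin , roundRobin-fair , behaviour , valid))
  where open Counterexample R′ (λ l {μ} → proj₁ ∘ proj₁ (R′≐ l) {μ}) R′-moves
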